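{- Let $1 < \kappa < \lambda$ be cardinals with $\lambda$ regular, and suppose that there is a stationary set $S \subseteq \lambda$ such that $\mathsf{sDSR}({<}\kappa, S)$ holds. Then $\square(\lambda, {<}\kappa)$ fails.
   Context: For an ordinal $\alpha$ and a set $S$ of ordinals, $S$ reflects at $\alpha$ if $\mathrm{cf}(\alpha) > \omega$ and $S \cap \alpha$ is stationary in $\alpha$. For $\lambda$ regular uncountable, $S \subseteq \lambda$ stationary and $\kappa \le \lambda$, $\mathsf{sDSR}({<}\kappa, S)$ is the assertion: whenever $\langle S_{\alpha,i} \mid \alpha<\lambda,\ i<j_\alpha\rangle$ is a matrix of stationary subsets of $S$ with $j_\alpha < \kappa$ for every $\alpha<\lambda$, there are an ordinal $\gamma<\lambda$ of uncountable cofinality and a stationary set $F \subseteq \gamma$ such that for every $\alpha \in F$ and every $i<j_\alpha$, $S_{\alpha,i}$ reflects at $\gamma$. A coherent sequence of length $\lambda$ is a sequence $\langle \mathcal{C}_\alpha \mid \alpha<\lambda \text{ limit}\rangle$ such that each $\mathcal{C}_\alpha$ is a nonempty collection of clubs in $\alpha$ and for every $C \in \mathcal{C}_\alpha$ and every limit point $\beta<\alpha$ of $C$, $C\cap\beta \in \mathcal{C}_\beta$; it has width ${<}\kappa$ if $|\mathcal{C}_\alpha|<\kappa$ for all limit $\alpha$. A thread is a club $T\subseteq\lambda$ such that $T\cap\beta\in\mathcal{C}_\beta$ for every limit point $\beta<\lambda$ of $T$. $\square(\lambda,{<}\kappa)$ asserts the existence of a coherent sequence of length $\lambda$ and width ${<}\kappa$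 with no thread. -}

-- Ordinals are well-ordered types, and an ordinal Λ is treated in the style of
-- von Neumann: an element α of Λ is an ordinal below Λ, identified with the
-- initial segment ↓ α of its predecessors, and Λ itself is the segment U.
-- A subset of Λ is a predicate, and two subsets are equal when they satisfy _≐_.

module Defs where

open import Level using (Level; suc; _⊔_)
open import Data.Product using (∃; ∃-syntax; Σ-syntax; _×_; proj₁)
open import Function.Bundles using (Bijection)
open import Induction.WellFounded using (WellFounded)
open import Relation.Binary.Bundles using (Setoid)
open import Relation.Binary.Core using (Rel)
open import Relation.Binary.Definitions using (_Respects_)
open import Relation.Binary.PropositionalEquality using (_≡_; setoid)
open import Relation.Binary.Structures using (IsStrictTotalOrder)
open import Relation.Nullary using (¬_)
open import Relation.Unary using (Pred; _∈_; _⊆_; _≐_; _∩_; U; ｛_｝; Satisfiable)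
open import Relation.Unary.Relation.Binary.Equality using (≐-setoid)
import Relation.Binary.Construct.On as On
import Relation.Binary.Construct.StrictToNonStrict as NonStrict

record Ordinal (a : Level) : Set (suc a) where
  field
    Carrier            : Set a
    _<_                : Rel Carrier a
    isStrictTotalOrder : IsStrictTotalOrder _≡_ _<_
    wellFounded        : WellFounded _<_

  infix 4 _<_

module Below {a : Level} (Λ : Ordinal a) where

  open Ordinal Λ public using (Carrier; _<_)
  open NonStrict _≡_ _<_ public using () renaming (_≤_ to infix 4 _≤_)

  private
    variable
      ℓ ℓ′ : Level

  ↓ : Carrier → Pred Carrier a
  ↓ α ξ = ξ < α

  Subset : Set (suc a)
  Subset = Pred Carrier a

  -- Every argument named δ is meant to be an initial segment, i.e. an ordinal ≤ Λ.

  Limit : Pred Carrier ℓ → Set (a ⊔ ℓ)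
  Limit δ = Satisfiable δ × (∀ ξ → ξ ∈ δ → ∃[ η ] η ∈ δ × ξ < η)

  Unbounded : Pred Carrier ℓ → Pred Carrier ℓ′ → Set (a ⊔ ℓ ⊔ ℓ′)
  Unbounded δ C = ∀ ξ → ξ ∈ δ → ∃[ η ] η ∈ C × ξ ≤ η

  -- There is a map from μ into δ with unbounded range; only the values of f
  -- below μ matter.
  CofinalMap : Carrier → Pred Carrier ℓ → Set (a ⊔ ℓ)
  CofinalMap μ δ =
    Σ[ f ∈ (Carrier → Carrier) ] (∀ i → i < μ → f i ∈ δ) ×
           Unbounded δ (λ η → ∃[ i ] i < μ × f i ≡ η)

  -- cf(δ) = μ.
  Cofinality : Pred Carrier ℓ → Carrier → Set (a ⊔ ℓ)
  Cofinality δ μ = CofinalMap μ δ × (∀ ν → ν < μ → ¬ CofinalMap ν δ)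

  -- w is the least limit ordinal, ω.
  IsOmega : Carrier → Set a
  IsOmega w = Limit (↓ w) × (∀ β → β < w → ¬ Limit (↓ β))

  UncountableCofinality : Carrier → Set a
  UncountableCofinality γ =
    ∃[ w ] ∃[ μ ] IsOmega w × Cofinality (↓ γ) μ × w < μ

  -- Λ is a regular infinite cardinal: a limit ordinal with cf(Λ) = Λ. (The
  -- identity is always cofinal, and cf(Λ) = Λ makes Λ an initial ordinal.)
  Regular : Set a
  Regular = Limit U × (∀ μ → ¬ CofinalMap μ U)

  ordinalSetoid : Carrier → Setoid a a
  ordinalSetoid μ = On.setoid {B = ∃ (↓ μ)} (setoid Carrier) proj₁

  collectionSetoid : Pred Subset a → Setoid (suc a) a
  collectionSetoid 𝒜 = On.setoid {B = ∃ 𝒜} (≐-setoid Carrier a) proj₁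

  IsCardinal : Carrier → Set a
  IsCardinal κ = ∀ μ → μ < κ → ¬ Bijection (ordinalSetoid μ) (ordinalSetoid κ)

  -- As a von Neumann ordinal, 1 is a singleton.
  IsOne : Carrier → Set a
  IsOne o = ∃[ z ] ↓ o ≐ ｛ z ｝

  -- |𝒜| < κ, for κ a cardinal.
  CardBelow : Pred Subset a → Carrier → Set (suc a)
  CardBelow 𝒜 κ = ∃[ μ ] μ < κ × Bijection (ordinalSetoid μ) (collectionSetoid 𝒜)

  -- The conjunct Limit (↓ β) excludes successors β = ξ + 1 with ξ ∈ C, for
  -- which C ∩ ↓ β is unbounded in β although sup (C ∩ β) = ξ.
  LimitPoint : Subset → Carrier → Set a
  LimitPoint C β = Limit (↓ β) × Unbounded (↓ β) (C ∩ ↓ β)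

  Club : Pred Carrier ℓ → Subset → Set (a ⊔ ℓ)
  Club δ C =
    C ⊆ δ × Unbounded δ C × (∀ β → β ∈ δ → LimitPoint C β → β ∈ C)

  Stationary : Pred Carrier ℓ → Subset → Set (suc a ⊔ ℓ)
  Stationary δ S = S ⊆ δ × (∀ C → Club δ C → Satisfiable (S ∩ C))

  ReflectsAt : Subset → Carrier → Set (suc a)
  ReflectsAt S γ = UncountableCofinality γ × Stationary (↓ γ) (S ∩ ↓ γ)

  -- Only the entries M α i with i < j α belong to the matrix.
  sDSR : Carrier → Subset → Set (suc a)
  sDSR κ S =
    (j : Carrier → Carrier) (M : Carrier → Carrier → Subset) →
    (∀ α → j α < κ) →
    (∀ α i → i < j α → M α i ⊆ S × Stationary U (M α i)) →
    ∃[ γ ] ∃[ F ] UncountableCofinality γ × Stationary (↓ γ) F ×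
      (∀ α → α ∈ F → ∀ i → i < j α → ReflectsAt (M α i) γ)

  -- The values of 𝒞 at non-limit α are irrelevant.
  record Coherent (𝒞 : Carrier → Pred Subset a) : Set (suc a) where
    field
      -- 𝒞 α is a collection of sets, so membership must not depend on the
      -- predicate chosen to represent a set.
      extensional : ∀ α → Limit (↓ α) → 𝒞 α Respects _≐_
      nonempty    : ∀ α → Limit (↓ α) → Satisfiable (𝒞 α)
      clubs       : ∀ α → Limit (↓ α) → ∀ C → C ∈ 𝒞 α → Club (↓ α) C
      coherent    : ∀ α → Limit (↓ α) → ∀ C → C ∈ 𝒞 α →
                    ∀ β → β < α → LimitPoint C β → (C ∩ ↓ β) ∈ 𝒞 β

  WidthBelow : Carrier → (Carrier → Pred Subset a) → Set (suc a)
  WidthBelow κ 𝒞 = ∀ α → Limit (↓ α) → CardBelow (𝒞 α) κ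

  Thread : (Carrier → Pred Subset a) → Subset → Set a
  Thread 𝒞 T = Club U T × (∀ β → LimitPoint T β → (T ∩ ↓ β) ∈ 𝒞 β)

  □ : Carrier → Set (suc a)
  □ κ = ∃[ 𝒞 ] Coherent 𝒞 × WidthBelow κ 𝒞 × ¬ (∃[ T ] Thread 𝒞 T)

-- Call (α, C) with C ∈ 𝒞 α a node if almost every β ∈ S (i.e. every β > α in
-- S ∩ E, for some club E) carries a D ∈ 𝒞 β end-extending C at the limit point α.
--
-- If the levels of the nodes are bounded, then for every large limit α and
-- C ∈ 𝒞 α the set of β ∈ S avoiding C is stationary. These sets form a matrix;
-- let γ and F be given by sDSR and D ∈ 𝒞 γ. Some α ∈ F is a limit point of D,
-- and some limit point β > α of D avoids D ∩ α, which D ∩ β end-extends.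
--
-- If they are unbounded, choose nodes at unboundedly many levels and order them
-- by end-extension. There is no antichain of size κ: at a suitable β ∈ S its
-- members would be extended by κ distinct members of 𝒞 β. A tree of regular
-- height Λ > κ without such antichains has a cofinal branch, whose union is a
-- thread.

module Submission where

open import Level using (Level; _⊔_)
open import Axiom.ExcludedMiddle using (ExcludedMiddle)
open import Data.Empty using (⊥; ⊥-elim)
open import Data.Nat as ℕ using (ℕ)
import Data.Nat.Properties as ℕ
open import Data.Product using (∃; ∃-syntax; Σ-syntax; _×_; _,_; proj₁; proj₂)
open import Data.Sum using (_⊎_; inj₁; inj₂)
open import Function.Base using (_∘_; id)
open import Function.Bundles using (Bijection)
open import Induction.WellFounded using (WfRec; module All; module FixPoint)
open import Relation.Binary.Core using (Rel)
open import Relation.Binary.Definitions using (Transitive; tri<; tri≈; tri>)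
open import Relation.Binary.PropositionalEquality
  using (_≡_; refl; sym; trans; cong; subst)
open import Relation.Binary.Structures using (IsStrictTotalOrder)
open import Relation.Nullary using (¬_; Dec; yes; no)
open import Relation.Nullary.Decidable using (True; toWitness; fromWitness; decidable-stable)
open import Relation.Unary using (Pred; _∈_; _⊆_; _≐_; _∩_; U)
open import Relation.Unary.Properties using (≐-sym; ≐-trans)
open import Defs

private
  variable
    ℓ ℓ′ : Level

-- Excluded middle and its consequences.

module Classical (em : ∀ {ℓ : Level} → ExcludedMiddle ℓ) where

  by-contradiction : {A : Set ℓ} → ¬ ¬ A → A
  by-contradiction = decidable-stable em

  ¬∀⇒∃¬ : {A : Set ℓ} {P : Pred A ℓ′} → ¬ (∀ x → P x) → ∃[ x ] ¬ P x
  ¬∀⇒∃¬ ¬all = by-contradiction λ none →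
    ¬all λ x → by-contradiction λ ¬p → none (x , ¬p)

  ¬→⇒×¬ : {A : Set ℓ} {B : Set ℓ′} → ¬ (A → B) → A × ¬ B
  ¬→⇒×¬ ¬f = by-contradiction (λ ¬a → ¬f (⊥-elim ∘ ¬a)) , λ b → ¬f (λ _ → b)

  -- Impredicativity: excluded middle gives every type a truth value, at any level.
  record Resize (b : Level) (A : Set ℓ) : Set b where
    constructor resize′
    field
      holds : True (em {P = A})

  resize : {b : Level} {A : Set ℓ} → A → Resize b A
  resize = resize′ ∘ fromWitness

  unresize : {b : Level} {A : Set ℓ} → Resize b A → A
  unresize = toWitness ∘ Resize.holds

  -- Well-orders and least elements.

  module Order {a : Level} (Λ : Ordinal a) where

    open Below Λ
    open IsStrictTotalOrder (Ordinal.isStrictTotalOrder Λ)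
      using (compare; irrefl) renaming (trans to <-trans)
    open Ordinal Λ using (wellFounded)

    ≮⇒≥ : ∀ {x y} → ¬ (x < y) → y ≤ x
    ≮⇒≥ {x} {y} x≮y with compare x y
    ... | tri< x<y _ _ = ⊥-elim (x≮y x<y)
    ... | tri≈ _ x≡y _ = inj₂ (sym x≡y)
    ... | tri> _ _ y<x = inj₁ y<x

    ≤-<-trans : ∀ {x y z} → x ≤ y → y < z → x < z
    ≤-<-trans (inj₁ x<y) y<z = <-trans x<y y<z
    ≤-<-trans (inj₂ refl) y<z = y<z

    <-≤-trans : ∀ {x y z} → x < y → y ≤ z → x < z
    <-≤-trans x<y (inj₁ y<z) = <-trans x<y y<z
    <-≤-trans x<y (inj₂ refl) = x<y

    <⇒≱ : ∀ {x y} → x < y → ¬ (y ≤ x)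
    <⇒≱ x<y y≤x = irrefl refl (<-≤-trans x<y y≤x)

    ≤⊎> : ∀ x y → x ≤ y ⊎ y < x
    ≤⊎> x y with compare x y
    ... | tri< x<y _ _ = inj₁ (inj₁ x<y)
    ... | tri≈ _ x≡y _ = inj₁ (inj₂ x≡y)
    ... | tri> _ _ y<x = inj₂ y<x

    max : ∀ x y → ∃[ m ] x ≤ m × y ≤ m × (m ≡ x ⊎ m ≡ y)
    max x y with ≤⊎> x y
    ... | inj₁ x≤y = y , x≤y , inj₂ refl , inj₂ refl
    ... | inj₂ y<x = x , inj₂ refl , inj₁ y<x , inj₁ refl

    Least : Pred Carrier ℓ → Pred Carrier _
    Least P x = P x × (∀ y → y < x → ¬ P y)

    least-element : (P : Pred Carrier ℓ) → ∃ P → ∃ (Least P)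
    least-element {ℓ} P (x , px) =
      All.wfRec wellFounded (a ⊔ ℓ) (λ x → P x → ∃ (Least P)) step x px
      where
      step : ∀ x → WfRec _<_ (λ x → P x → ∃ (Least P)) x → P x → ∃ (Least P)
      step x rec px with em {P = ∃[ y ] y < x × P y}
      ... | yes (y , y<x , py) = rec y<x py
      ... | no none = x , px , λ y y<x py → none (y , y<x , py)

    Least-unique : {P : Pred Carrier ℓ} {Q : Pred Carrier ℓ} → P ≐ Q →
                   ∀ {x y} → Least P x → Least Q y → x ≡ y
    Least-unique (P⊆Q , Q⊆P) {x} {y} (px , x-min) (qy , y-min) with compare x y
    ... | tri< x<y _ _ = ⊥-elim (y-min x x<y (P⊆Q px))
    ... | tri≈ _ x≡y _ = x≡y
    ... | tri> _ _ y<x = ⊥-elim (x-min y y<x (Q⊆P qy))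

    -- At a least `k` with `t k < k`, monotonicity gives `t (t k) < t k`, so `t k` is a smaller
    -- counterexample.
    increasing⇒inflationary : (t : Carrier → Carrier) → (∀ {i k} → i < k → t i < t k) →
                              ∀ i → i ≤ t i
    increasing⇒inflationary t t-mono i = ≮⇒≥ λ tᵢ<i →
      let k , tₖ<k , k-min = least-element (λ i → t i < i) (i , tᵢ<i)
      in k-min (t k) tₖ<k (t-mono tₖ<k)

    module _ {B : Set ℓ} (b₀ : B) (μ : Carrier) {P : Carrier → Pred B ℓ′}
             (witness : ∀ i → i < μ → ∃ (P i)) where

      -- The witnesses are pairs, so selecting them is projection; excluded middle extends the
      -- selection to a total function, with the default `b₀` outside `μ`.
      choice : ∃[ f ] (∀ i → i < μ → P i (f i))
      choice = (λ i → proj₁ (pick i em)) , λ i → proj₂ (pick i em)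
        where
        pick : ∀ i → Dec (i < μ) → ∃[ b ] (i < μ → P i b)
        pick i (yes i<μ) = proj₁ (witness i i<μ) , λ _ → proj₂ (witness i i<μ)
        pick i (no i≮μ) = b₀ , ⊥-elim ∘ i≮μ

    limitPoint-cong : ∀ {C C′ : Subset} {β} → (∀ {ξ} → ξ < β → C ξ → C′ ξ) →
                      LimitPoint C β → LimitPoint C′ β
    limitPoint-cong C⊆C′ (lim , unbdd) = lim , λ ξ ξ<β →
      let η , (η∈C , η<β) , ξ≤η = unbdd ξ ξ<β in η , (C⊆C′ η<β η∈C , η<β) , ξ≤η

    limit⇒limitPoint : ∀ {C : Subset} {β} → Limit (↓ β) →
                       (∀ ξ → ξ < β → ∃[ η ] η < β × ξ < η × η ∈ C) → LimitPoint C β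
    limit⇒limitPoint lim above = lim , λ ξ ξ<β →
      let η , η<β , ξ<η , η∈C = above ξ ξ<β in η , (η∈C , η<β) , inj₁ ξ<η

    -- Countable sequences and stationary sets.

    -- For a nonzero limit δ this says that cf(δ) > ω.
    SequencesBounded : Pred Carrier ℓ → Set _
    SequencesBounded δ = (s : ℕ → Carrier) → (∀ n → s n ∈ δ) → ∃[ b ] b ∈ δ × (∀ n → s n < b)

    module _ {w : Carrier} (w-limit : Limit (↓ w)) where

      private
        finite : ℕ → ∃ (↓ w)
        finite ℕ.zero = proj₁ w-limit
        finite (ℕ.suc n) =
          let η , η<w , _ = proj₂ w-limit (proj₁ (finite n)) (proj₂ (finite n)) in η , η<w

        e : ℕ → Carrier
        e = proj₁ ∘ finite

        e-step : ∀ n → e n < e (ℕ.suc n)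
        e-step n = proj₂ (proj₂ (proj₂ w-limit (e n) (proj₂ (finite n))))

        e-mono : ∀ {m n} → m ℕ.<′ n → e m < e n
        e-mono {m} ℕ.≤′-refl = e-step m
        e-mono (ℕ.≤′-step {n} m<n) = <-trans (e-mono m<n) (e-step n)

        e-injective : ∀ m n → e m ≡ e n → m ≡ n
        e-injective m n eq with ℕ.<-cmp m n
        ... | tri< m<n _ _ = ⊥-elim (irrefl eq (e-mono (ℕ.<⇒<′ m<n)))
        ... | tri≈ _ m≡n _ = m≡n
        ... | tri> _ _ n<m = ⊥-elim (irrefl (sym eq) (e-mono (ℕ.<⇒<′ n<m)))

        index : Carrier → ℕ
        index i with em {P = ∃[ n ] e n ≡ i}
        ... | yes (n , _) = n
        ... | no _ = ℕ.zero

        index-e : ∀ n → index (e n) ≡ n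
        index-e n with em {P = ∃[ m ] e m ≡ e n}
        ... | yes (m , eq) = e-injective m n eq
        ... | no none = ⊥-elim (none (n , refl))

      -- An unbounded sequence, carried along the embedding `e` of ℕ into `w`, becomes a cofinal map
      -- from `w`: `index` inverts `e` and is zero off its range.
      no-cofinal-ω⇒sequencesBounded : (δ : Pred Carrier ℓ) → ¬ CofinalMap w δ → SequencesBounded δ
      no-cofinal-ω⇒sequencesBounded δ ¬cof s s∈δ = by-contradiction λ unbdd →
        ¬cof (s ∘ index , (λ i _ → s∈δ (index i)) , λ ξ ξ∈δ →
          let n , sₙ≮ξ = ¬∀⇒∃¬ (λ s<ξ → unbdd (ξ , ξ∈δ , s<ξ))
          in s n , (e n , proj₂ (finite n) , cong s (index-e n)) , ≮⇒≥ sₙ≮ξ)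

    module _ (δ : Pred Carrier ℓ) (δ-lower : ∀ {x y} → x < y → y ∈ δ → x ∈ δ)
             (bounded : SequencesBounded δ) (S : Subset) (S-stat : Stationary δ S) where

      abstract
        -- S meets the club of limit ordinals closed under p ↦ some η > p with R p η.
        stationary-meets : {ρ : Level} {R : Rel Carrier ρ} → (∀ {p q η} → p ≤ q → R q η → R p η) →
          (∀ p → p ∈ δ → ∃[ η ] η ∈ δ × p < η × R p η) →
          ∃[ ξ ] ξ ∈ S × Limit (↓ ξ) × (∀ p → p < ξ → ∃[ η ] η < ξ × p < η × R p η)
        stationary-meets {ρ} {R} antitone next =
          let ξ , ξ∈S , ξ∈C = proj₂ S-stat C (C⊆δ , C-unbounded , C-closed)
              _ , lim , closed = unresize ξ∈C
          in ξ , ξ∈S , lim , closed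
          where
          Closed : Carrier → Set (a ⊔ ρ)
          Closed ξ = ∀ p → p < ξ → ∃[ η ] η < ξ × p < η × R p η

          C : Subset
          C ξ = Resize a (ξ ∈ δ × Limit (↓ ξ) × Closed ξ)

          C⊆δ : C ⊆ δ
          C⊆δ = proj₁ ∘ unresize

          C-closed : ∀ β → β ∈ δ → LimitPoint C β → β ∈ C
          C-closed β β∈δ (lim , unbdd) = resize (β∈δ , lim , λ p p<β →
            let q , q<β , p<q = proj₂ lim p p<β
                ξ , (ξ∈C , ξ<β) , q≤ξ = unbdd q q<β
                η , η<ξ , p<η , r = proj₂ (proj₂ (unresize ξ∈C)) p (<-≤-trans p<q q≤ξ)
            in η , <-trans η<ξ ξ<β , p<η , r)

          C-unbounded : Unbounded δ C
          C-unbounded ξ₀ ξ₀∈δ =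
            ξ , resize (ξ∈δ ,
              ((ξ₀ , s<ξ 0) , λ p p<ξ → let η , η<ξ , p<η , _ = closed p p<ξ in η , η<ξ , p<η) ,
              closed) ,
            inj₁ (s<ξ 0)
            where
            seq : ℕ → ∃ δ
            seq ℕ.zero = ξ₀ , ξ₀∈δ
            seq (ℕ.suc n) = let η , η∈δ , _ = next (proj₁ (seq n)) (proj₂ (seq n)) in η , η∈δ

            s : ℕ → Carrier
            s = proj₁ ∘ seq

            sup : ∃ (Least (λ b → b ∈ δ × (∀ n → s n < b)))
            sup = least-element _ (bounded s (proj₂ ∘ seq))

            ξ : Carrier
            ξ = proj₁ sup

            ξ∈δ : ξ ∈ δ
            ξ∈δ = proj₁ (proj₁ (proj₂ sup))

            s<ξ : ∀ n → s n < ξ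
            s<ξ = proj₂ (proj₁ (proj₂ sup))

            closed : Closed ξ
            closed p p<ξ =
              -- As `ξ` is the least strict bound, some `s n` is at least `p`. The step from `s n`
              -- to its successor in the sequence, pulled back to `p` by `antitone`, serves.
              let n , sₙ≮p = ¬∀⇒∃¬ (λ s<p → proj₂ (proj₂ sup) p p<ξ (δ-lower p<ξ ξ∈δ , s<p))
                  p≤sₙ = ≮⇒≥ sₙ≮p
                  _ , _ , sₙ<η , r = next (s n) (proj₂ (seq n))
              in s (ℕ.suc n) , s<ξ (ℕ.suc n) , ≤-<-trans p≤sₙ sₙ<η , antitone p≤sₙ r

    -- Bounds and recursive enumerations in a regular ordinal.

    module RegularOrdinal (regular : Regular) where

      origin : Carrier
      origin = proj₁ (proj₁ (proj₁ regular))

      above : ∀ ξ → ∃[ η ] ξ < η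
      above ξ = let η , _ , ξ<η = proj₂ (proj₁ regular) ξ _ in η , ξ<η

      bound : ∀ μ (f : Carrier → Carrier) → ∃[ b ] (∀ i → i < μ → f i < b)
      bound μ f = by-contradiction λ unbdd → proj₂ regular μ (f , (λ _ _ → _) , λ ξ _ →
        let i , ¬fᵢ<ξ = ¬∀⇒∃¬ (λ f<ξ → unbdd (ξ , f<ξ))
            i<μ , fᵢ≮ξ = ¬→⇒×¬ ¬fᵢ<ξ
        in f i , (i , i<μ , refl) , ≮⇒≥ fᵢ≮ξ)

      least : Pred Carrier ℓ → Carrier
      least P = go em
        module least where
        go : Dec (∃ P) → Carrier
        go (yes p) = proj₁ (least-element P p)
        go (no _) = origin

      least-satisfies : (P : Pred Carrier ℓ) → ∃ P → P (least P)
      least-satisfies P p with em {P = ∃ P}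
      ... | yes p′ = proj₁ (proj₂ (least-element P p′))
      ... | no none = ⊥-elim (none p)

      -- Unfolding the recursion in `Enumeration` requires a step that respects pointwise equality
      -- of the recursive values; such a change alters `Next` only up to `_≐_`.
      least-cong : {P Q : Pred Carrier ℓ} → P ≐ Q → least P ≡ least Q
      least-cong {P = P} {Q} P≐Q = go-cong em em
        where
        go-cong : ∀ d d′ → least.go P d ≡ least.go Q d′
        go-cong (yes p) (yes q) =
          Least-unique P≐Q (proj₂ (least-element P p)) (proj₂ (least-element Q q))
        go-cong (yes (x , px)) (no ¬q) = ⊥-elim (¬q (x , proj₁ P≐Q px))
        go-cong (no ¬p) (yes (x , qx)) = ⊥-elim (¬p (x , proj₂ P≐Q qx))
        go-cong (no _) (no _) = refl

      module _ (X : Pred Carrier ℓ) (X-unbounded : ∀ ξ → ∃[ η ] η ∈ X × ξ < η)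
               (h : Carrier → Carrier) where

        private
          Next : ∀ i → WfRec _<_ (λ _ → Carrier) i → Pred Carrier _
          Next i rec y = y ∈ X × (∀ {k} (k<i : k < i) → h (rec k<i) < y)

          module Enumeration = FixPoint wellFounded (λ _ → Carrier) (λ i rec → least (Next i rec))
            (λ i rec≡ → least-cong
              ( (λ (y∈X , h<y) → y∈X , λ k<i → subst (λ z → h z < _) (rec≡ k<i) (h<y k<i))
              , (λ (y∈X , h<y) → y∈X , λ k<i → subst (λ z → h z < _) (sym (rec≡ k<i)) (h<y k<i))))

          t : Carrier → Carrier
          t = All.wfRec wellFounded a (λ _ → Carrier) (λ i rec → least (Next i rec))

          t-next : ∀ i → Next i (λ {k} _ → t k) (t i)
          t-next i = subst (Next i (λ {k} _ → t k)) (sym Enumeration.unfold-wfRec)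
            (least-satisfies (Next i (λ {k} _ → t k))
              (let b , h<b = bound i (h ∘ t)
                   y , y∈X , b<y = X-unbounded b
               in y , y∈X , λ k<i → <-trans (h<b _ k<i) b<y))

        -- By recursion, `t i` is the least element of `X` beyond `h (t k)` for all `k < i`;
        -- regularity bounds these values. The function `h` prescribes how far to skip after each
        -- choice.
        enumeration : ∃[ t ] (∀ i → t i ∈ X) × (∀ {k i} → k < i → h (t k) < t i)
        enumeration = t , (λ i → proj₁ (t-next i)) , λ k<i → proj₂ (t-next _) k<i

      -- Antichains and branches in trees of regular height.

      -- A form of Kurepa's theorem, without pressing down. If no cone is an unbounded
      -- chain, each x has an f x bounding its cone or two incomparable elements of it.
      -- Thin out to a range of s that skips past f x after each x. A level there that
      -- is unbounded contains an antichain of type κ. Otherwise the levels below κ miss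
      -- some element, and the branch of length κ below it sheds, at each node, an
      -- incomparable element, and these form an antichain.
      module Tree (_≺_ : Rel Carrier ℓ) (≺⇒< : ∀ {x y} → x ≺ y → x < y)
                  (≺-trans : Transitive _≺_)
                  (≺-chain : ∀ {x y z} → x ≺ z → y ≺ z → x < y → x ≺ y) where

        UnboundedCone : Carrier → Set _
        UnboundedCone x = (∀ ξ → ∃[ y ] x ≺ y × ξ < y) ×
                          (∀ {y z} → x ≺ y → x ≺ z → y < z → y ≺ z)

        BoundOrSplit : Carrier → Carrier → Set _
        BoundOrSplit x b = (∀ y → x ≺ y → y < b) ⊎
          (∃[ u ] ∃[ v ] x ≺ u × x ≺ v × u < v × v < b × ¬ u ≺ v)

        boundOrSplit : ∀ x → ¬ UnboundedCone x → ∃ (BoundOrSplit x)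
        boundOrSplit x ¬cone with em {P = ∃[ b ] (∀ y → x ≺ y → y < b)}
        ... | yes (b , ≺<b) = b , inj₁ ≺<b
        ... | no ¬bounded = by-contradiction λ none → ¬cone
          ( (λ ξ →
              let η , ξ<η = above ξ
                  y , ¬≺< = ¬∀⇒∃¬ (λ ≺<η → ¬bounded (η , ≺<η))
                  x≺y , y≮η = ¬→⇒×¬ ¬≺<
              in y , x≺y , <-≤-trans ξ<η (≮⇒≥ y≮η))
          , λ {u} {v} x≺u x≺v u<v → by-contradiction λ u⊀v →
              let b , v<b = above v in
              none (b , inj₂ (u , v , x≺u , x≺v , u<v , v<b , u⊀v)))

        -- Since `t` increases and `_≺_` refines `_<_`, excluding `t i ≺ t k` for `i < k` already
        -- makes the members incomparable.
        Antichain : Carrier → Set _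
        Antichain κ = Σ[ t ∈ (Carrier → Carrier) ] (∀ {i k} → i < k → k < κ → t i < t k × ¬ t i ≺ t k)

        module Sparse (κ : Carrier) (f : Carrier → Carrier)
                      (f-splits : ∀ x → BoundOrSplit x (f x))
                      (s : Carrier → Carrier) (s-mono : ∀ {i k} → i < k → s i < s k)
                      (f-s< : ∀ {i k} → i < k → f (s i) < s k) where

          private
            s-reflects : ∀ {i k} → s i < s k → i < k
            s-reflects {i} {k} sᵢ<sₖ with ≤⊎> k i
            ... | inj₁ (inj₁ k<i) = ⊥-elim (<⇒≱ sᵢ<sₖ (inj₁ (s-mono k<i)))
            ... | inj₁ (inj₂ refl) = ⊥-elim (irrefl refl sᵢ<sₖ)
            ... | inj₂ i<k = i<k

            -- The height of s q in the tree formed by the range of s is at most i.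
            data Height≤ (i q : Carrier) : Set (a ⊔ ℓ) where
              height≤ : (∀ p → s p ≺ s q → ∃[ j ] j < i × Height≤ j p) → Height≤ i q

            OfHeight : Carrier → Pred Carrier _
            OfHeight i q = Height≤ i q × (∀ j → j < i → ¬ Height≤ j q)

            sameHeight⇒antichain : ∀ {i p q} → p ∈ OfHeight i → q ∈ OfHeight i → ¬ s p ≺ s q
            sameHeight⇒antichain (_ , p-min) (height≤ below , _) sₚ≺s_q =
              let j , j<i , p≤j = below _ sₚ≺s_q in p-min j j<i p≤j

            unbounded-level⇒antichain : ∀ i → (∀ ξ → ∃[ q ] q ∈ OfHeight i × ξ < q) → Antichain κ
            unbounded-level⇒antichain i unbdd =
              let t , t∈level , t-mono = enumeration (OfHeight i) unbdd id
              in s ∘ t , λ k<l _ → s-mono (t-mono k<l) , sameHeight⇒antichain (t∈level _) (t∈level _)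

            module LongBranch (q : Carrier) (high : ∀ i → i < κ → ¬ Height≤ i q) where

              -- Take the least predecessor of `s q` whose height is not below `i`. Its own
              -- predecessors all have height below `i`, so its height is exactly `i`.
              below-q : ∀ i → i < κ → ∃[ p ] p ∈ OfHeight i × s p ≺ s q
              below-q i i<κ =
                let p₀ , ¬below = ¬∀⇒∃¬ (λ below → high i i<κ (height≤ below))
                    p₀≺q , p₀-high = ¬→⇒×¬ ¬below
                    p , (p≺q , p-high) , p-min =
                      least-element (λ p → s p ≺ s q × ¬ (∃[ j ] j < i × Height≤ j p)) (p₀ , p₀≺q , p₀-high)
                in p , (height≤ (λ p′ p′≺p → by-contradiction λ p′-high →
                          p-min p′ (s-reflects (≺⇒< p′≺p)) (≺-trans p′≺p p≺q , p′-high))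
                       , λ j j<i p≤j → p-high (j , j<i , p≤j)) , p≺q

              -- Below `s q` the tree is a chain, so `p′ < p` would put `s p′` under `s p` and give
              -- it height below `i`.
              branch-mono : ∀ {i k p p′} → i < k → p ∈ OfHeight i → p′ ∈ OfHeight k →
                            s p ≺ s q → s p′ ≺ s q → p < p′
              branch-mono {i} {p = p} {p′} i<k (p≤i , p-min) (_ , p′-min) p≺q p′≺q with compare p p′
              ... | tri< p<p′ _ _ = p<p′
              ... | tri≈ _ refl _ = ⊥-elim (p′-min _ i<k p≤i)
              ... | tri> _ _ p′<p with p≤i
              ...   | height≤ below =
                let j , j<i , p′≤j = below p′ (≺-chain p′≺q p≺q (s-mono p′<p))
                in ⊥-elim (p′-min j (<-trans j<i i<k) p′≤j)

              -- By sparseness `s q` lies beyond `f (s p)`, so `f (s p)` does not bound the cone of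
              -- `s p` and the cone splits below it. Of the two incomparable elements at most one is
              -- under `s q`, whose predecessors form a chain.
              split-off : ∀ {p} → s p ≺ s q → ∃[ x ] s p ≺ x × x < f (s p) × ¬ x ≺ s q
              split-off {p} p≺q with f-splits (s p)
              ... | inj₁ ≺<f = ⊥-elim (<⇒≱ (≺<f (s q) p≺q) (inj₁ (f-s< (s-reflects (≺⇒< p≺q)))))
              ... | inj₂ (u , v , p≺u , p≺v , u<v , v<f , u⊀v) with em {P = u ≺ s q}
              ...   | no u⊀q = u , p≺u , <-trans u<v v<f , u⊀q
              ...   | yes u≺q = v , p≺v , v<f , λ v≺q → u⊀v (≺-chain u≺q v≺q u<v)

              OffBranch : Carrier → Carrier → Set _
              OffBranch i x =
                ∃[ p ] p ∈ OfHeight i × s p ≺ s q × s p ≺ x × x < f (s p) × ¬ x ≺ s q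

              offBranch : ∀ i → i < κ → ∃ (OffBranch i)
              offBranch i i<κ =
                let p , p∈level , p≺q = below-q i i<κ
                    x , p≺x , x<f , x⊀q = split-off p≺q
                in x , p , p∈level , p≺q , p≺x , x<f , x⊀q

              antichain : Antichain κ
              antichain =
                let t , t-prop = choice origin κ offBranch
                in t , λ {i} {k} i<k k<κ →
                  let p , p∈level , p≺q , p≺x , x<f , x⊀q = t-prop i (<-trans i<k k<κ)
                      p′ , p′∈level , p′≺q , p′≺x′ , _ = t-prop k k<κ
                      -- Sparseness places `x` before `s p′`. Were `x ≺ x′`, then `≺-chain` below
                      -- `x′` would give `x ≺ s p′`, and so `x ≺ s q`.
                      x<p′ = <-trans x<f (f-s< (branch-mono i<k p∈level p′∈level p≺q p′≺q))
                  in <-trans x<p′ (≺⇒< p′≺x′) ,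
                     λ x≺x′ → x⊀q (≺-trans (≺-chain x≺x′ p′≺x′ x<p′) p′≺q)

          splitting⇒antichain : Antichain κ
          splitting⇒antichain with em {P = ∃[ i ] (∀ ξ → ∃[ q ] q ∈ OfHeight i × ξ < q)}
          ... | yes (i , unbdd) = unbounded-level⇒antichain i unbdd
          ... | no all-bounded =
            let level-bound , q∉level = choice origin κ {P = λ i b → ∀ q → q ∈ OfHeight i → ¬ b < q}
                  λ i _ →
                    let b , ¬above = ¬∀⇒∃¬ (λ unbdd → all-bounded (i , unbdd))
                    in b , λ q q∈level b<q → ¬above (q , q∈level , b<q)
                -- Regularity gives a `q` beyond all levels below `κ`, so the height of `s q` is at
                -- least `κ`.
                q , bound<q = bound κ level-bound
            in LongBranch.antichain q λ i i<κ q≤i →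
              let j , q≤j , j-min = least-element (λ i → Height≤ i q) (i , q≤i)
                  j<κ = ≤-<-trans (≮⇒≥ (λ i<j → j-min i i<j q≤i)) i<κ
              in q∉level j j<κ q (q≤j , j-min) (bound<q j j<κ)

        unboundedCone⊎antichain : ∀ κ → ∃ UnboundedCone ⊎ Antichain κ
        unboundedCone⊎antichain κ with em {P = ∃ UnboundedCone}
        ... | yes cone = inj₁ cone
        ... | no ¬cone = inj₂ (Sparse.splitting⇒antichain κ f (proj₂ ∘ split) s s-mono f-s<)
          where
          split : ∀ x → ∃ (BoundOrSplit x)
          split x = boundOrSplit x (λ cone → ¬cone (x , cone))

          f : Carrier → Carrier
          f = proj₁ ∘ split

          -- The maximum is taken because `f x` need not exceed `x` when the cone of `x` is empty.
          sparse : ∃[ s ] (∀ i → s i ∈ U) × (∀ {k i} → k < i → proj₁ (max (s k) (f (s k))) < s i)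
          sparse = enumeration U (λ ξ → let η , ξ<η = above ξ in η , _ , ξ<η)
                     (λ x → proj₁ (max x (f x)))

          s : Carrier → Carrier
          s = proj₁ sparse

          s-mono : ∀ {i k} → i < k → s i < s k
          s-mono {i} i<k = ≤-<-trans (proj₁ (proj₂ (max (s i) (f (s i))))) (proj₂ (proj₂ sparse) i<k)

          f-s< : ∀ {i k} → i < k → f (s i) < s k
          f-s< {i} i<k = ≤-<-trans (proj₁ (proj₂ (proj₂ (max (s i) (f (s i)))))) (proj₂ (proj₂ sparse) i<k)

    -- Cardinals and small collections.

    module _ {κ μ : Carrier} (κ-cardinal : IsCardinal κ) (μ<κ : μ < κ) (k : Carrier → Carrier)
             (k<μ : ∀ i → i < κ → k i < μ)
             (k-distinct : ∀ {i l} → i < l → l < κ → ¬ k i ≡ k l) where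

      -- The Schröder–Bernstein argument for k and the inclusion of μ in κ.
      private
        data Orbit : Carrier → Set a where
          base : ∀ {y} → y < κ → ¬ y < μ → Orbit y
          step : ∀ {y} → y < κ → Orbit y → Orbit (k y)

        k-injective : ∀ {x y} → x < κ → y < κ → k x ≡ k y → x ≡ y
        k-injective {x} {y} x<κ y<κ eq with compare x y
        ... | tri< x<y _ _ = ⊥-elim (k-distinct x<y y<κ eq)
        ... | tri≈ _ x≡y _ = x≡y
        ... | tri> _ _ y<x = ⊥-elim (k-distinct y<x x<κ (sym eq))

        shift : Carrier → Carrier
        shift y with em {P = Orbit y}
        ... | yes _ = k y
        ... | no _ = y

        shift<μ : ∀ y → y < κ → shift y < μ
        shift<μ y y<κ with em {P = Orbit y}
        ... | yes _ = k<μ y y<κ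
        ... | no ¬orbit = by-contradiction (¬orbit ∘ base y<κ)

        shift-injective : ∀ {x y} → x < κ → y < κ → shift x ≡ shift y → x ≡ y
        shift-injective {x} {y} x<κ y<κ eq with em {P = Orbit x} | em {P = Orbit y}
        ... | yes _ | yes _ = k-injective x<κ y<κ eq
        ... | yes ox | no ¬oy = ⊥-elim (¬oy (subst Orbit eq (step x<κ ox)))
        ... | no ¬ox | yes oy = ⊥-elim (¬ox (subst Orbit (sym eq) (step y<κ oy)))
        ... | no _ | no _ = eq

        shift-orbit : ∀ {y} → Orbit y → shift y ≡ k y
        shift-orbit {y} oy with em {P = Orbit y}
        ... | yes _ = refl
        ... | no ¬oy = ⊥-elim (¬oy oy)

        shift-¬orbit : ∀ {y} → ¬ Orbit y → shift y ≡ y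
        shift-¬orbit {y} ¬oy with em {P = Orbit y}
        ... | yes oy = ⊥-elim (¬oy oy)
        ... | no _ = refl

        shift-surjective : ∀ z → z < μ → ∃[ y ] y < κ × shift y ≡ z
        shift-surjective z z<μ with em {P = Orbit z}
        ... | no ¬oz = z , <-trans z<μ μ<κ , shift-¬orbit ¬oz
        ... | yes (base _ z≮μ) = ⊥-elim (z≮μ z<μ)
        ... | yes (step y<κ oy) = _ , y<κ , shift-orbit oy

      cardinal⇒no-injection-below : ⊥
      cardinal⇒no-injection-below =
        -- `shift` maps `κ` bijectively onto `μ`, whereas `IsCardinal` speaks of maps from `μ` to
        -- `κ`; `g` is the inverse.
        let g , g-prop = choice κ μ shift-surjective in
        κ-cardinal μ μ<κ record
          { to = λ (z , z<μ) → g z , proj₁ (g-prop z z<μ)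
          ; cong = cong g
          ; bijective =
              (λ { {z , z<μ} {z′ , z′<μ} eq →
                   trans (sym (proj₂ (g-prop z z<μ))) (trans (cong shift eq) (proj₂ (g-prop z′ z′<μ))) })
            , λ (y , y<κ) → (shift y , shift<μ y y<κ) , λ { {z , z<μ} refl →
                shift-injective (proj₁ (g-prop z z<μ)) y<κ (proj₂ (g-prop z z<μ)) }
          }

    enumerate-collection : ∀ {𝒜 : Pred Subset a} {κ} → CardBelow 𝒜 κ →
      ∃[ μ ] μ < κ × (Σ[ A ∈ (Carrier → Subset) ] (∀ i → i < μ → A i ∈ 𝒜) ×
                      (∀ C → C ∈ 𝒜 → ∃[ i ] i < μ × A i ≐ C))
    enumerate-collection {𝒜} (μ , μ<κ , bij) =
      let A , A-prop = choice {B = Subset} (↓ μ) μ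
            -- All proofs of `i < μ` are covered, since `to` takes the proof as part of its
            -- argument; its value depends on it only up to `_≐_`.
            {P = λ i C → C ∈ 𝒜 × (∀ i<μ → C ≐ proj₁ (to (i , i<μ)))}
            λ i i<μ → proj₁ (to (i , i<μ)) , proj₂ (to (i , i<μ)) , λ i<μ′ → B.cong refl
      in μ , μ<κ , A , (λ i i<μ → proj₁ (A-prop i i<μ)) , λ C C∈𝒜 →
        let (i , i<μ) , eq = B.surjective (C , C∈𝒜)
        in i , i<μ , ≐-trans (proj₂ (A-prop i i<μ) i<μ) (eq refl)
      where
      module B = Bijection bij
      open B using (to)

    uncountableCofinality⇒sequencesBounded : ∀ {γ} → UncountableCofinality γ → SequencesBounded (↓ γ)
    uncountableCofinality⇒sequencesBounded {γ} (w , μ , (w-limit , _) , (_ , minimal) , w<μ) =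
      no-cofinal-ω⇒sequencesBounded w-limit (↓ γ) (minimal w w<μ)

    stationary⇒satisfiable : ∀ {γ} {F : Subset} → Stationary (↓ γ) F → ∃[ ξ ] ξ < γ × ξ ∈ F
    stationary⇒satisfiable {γ} (_ , meets) =
      let ξ , ξ∈F , ξ<γ = meets (↓ γ) (id , (λ ξ ξ<γ → ξ , ξ<γ , inj₂ refl) , λ _ β<γ _ → β<γ)
      in ξ , ξ<γ , ξ∈F

    -- Nodes of a coherent sequence.

    module Square (regular : Regular) {κ o : Carrier} (κ-cardinal : IsCardinal κ) (o<κ : o < κ)
                  {S : Subset} (S-stat : Stationary U S) (reflection : sDSR κ S)
                  {𝒞 : Carrier → Pred Subset a} (coh : Coherent 𝒞) (width : WidthBelow κ 𝒞) where

      open RegularOrdinal regular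
      open Coherent coh

      -- The constant matrix `S` with rows of length `o` reflects at some `γ` of uncountable
      -- cofinality, so ω is an element of `Λ`; by regularity no map from it is cofinal.
      Λ-sequencesBounded : SequencesBounded U
      Λ-sequencesBounded =
        let _ , _ , (w , _ , (w-limit , _) , _) , _ =
              reflection (λ _ → o) (λ _ _ → S) (λ _ → o<κ) (λ _ _ _ → id , S-stat)
        in no-cofinal-ω⇒sequencesBounded w-limit U (proj₂ regular w)

      Extends : Carrier → Subset → Carrier → Set _
      Extends α C β = ∃[ D ] D ∈ 𝒞 β × LimitPoint D α × (D ∩ ↓ α) ≐ C

      -- Resized because `Extends` quantifies over subsets, which lifts it one level above a
      -- `Subset`.
      Avoiding : Carrier → Subset → Subset
      Avoiding α C β = Resize a (β ∈ S × α < β × ¬ Extends α C β)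

      Node : Carrier → Set _
      Node α = Limit (↓ α) × (Σ[ C ∈ Subset ] C ∈ 𝒞 α × (Σ[ E ∈ Subset ] Club U E ×
        (∀ β → β ∈ E → β ∈ S → α < β → Extends α C β)))

      -- A club `E` disjoint from `Avoiding α C` would make `C` a node.
      ¬Node⇒stationary : ∀ {α} → ¬ Node α → Limit (↓ α) → ∀ C → C ∈ 𝒞 α → Stationary U (Avoiding α C)
      ¬Node⇒stationary ¬node lim C C∈𝒞 = _ , λ E E-club → by-contradiction λ disjoint →
        ¬node (lim , C , C∈𝒞 , E , E-club , λ β β∈E β∈S α<β → by-contradiction λ ¬ext →
          disjoint (β , resize (β∈S , α<β , ¬ext) , β∈E))

      -- Bounded node levels contradict reflection.

      module BoundedNodes (α₀ : Carrier) (no-node : ∀ α → α₀ < α → ¬ Node α) where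

        -- The last condition forces `α₀ < γ`: a set lying above `α₀` can reflect at `γ` only if it
        -- has elements below `γ`.
        Rows : (μ : Carrier) (M : Carrier → Subset) → Set _
        Rows μ M = μ < κ × (∀ i → i < μ → M i ⊆ S × Stationary U (M i)) ×
                   (∃[ i ] i < μ × (∀ {β} → β ∈ M i → α₀ < β))

        Covers : (α μ : Carrier) (M : Carrier → Subset) → Set _
        Covers α μ M = ∀ C → C ∈ 𝒞 α → ∃[ i ] i < μ × M i ⊆ Avoiding α C

        rows-at : ∀ α → Limit (↓ α) → α₀ < α →
                  ∃[ μ ] Σ[ M ∈ (Carrier → Subset) ] Rows μ M × Covers α μ M
        rows-at α lim α₀<α =
          let μ , μ<κ , A , A∈𝒞 , A-onto = enumerate-collection (width α lim)
              C , C∈𝒞 = nonempty α lim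
              i , i<μ , _ = A-onto C C∈𝒞
          in μ , Avoiding α ∘ A ,
             ( μ<κ
             , (λ i i<μ → proj₁ ∘ unresize ,
                  ¬Node⇒stationary (no-node α α₀<α) lim (A i) (A∈𝒞 i i<μ))
             , i , i<μ , λ β∈ → <-trans α₀<α (proj₁ (proj₂ (unresize β∈)))) ,
             λ C C∈𝒞 →
               let i , i<μ , Aᵢ≐C = A-onto C C∈𝒞
               in i , i<μ , λ β∈ →
                 let β∈S , α<β , ¬ext = unresize β∈
                 in resize (β∈S , α<β , λ (D , D∈𝒞 , α-lim , D≐C) →
                      ¬ext (D , D∈𝒞 , α-lim , ≐-trans D≐C (≐-sym Aᵢ≐C)))

        some-limit : ∃[ α ] Limit (↓ α) × α₀ < α
        some-limit =
          let ξ , _ , lim , closed = stationary-meets U _ Λ-sequencesBounded S S-stat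
                {R = λ _ η → α₀ < η} (λ _ → id)
                (λ p _ → let m , p≤m , α₀≤m , _ = max p α₀
                             η , m<η = above m
                         in η , _ , ≤-<-trans p≤m m<η , ≤-<-trans α₀≤m m<η)
              (p , p<ξ) , _ = lim
              η , η<ξ , _ , α₀<η = closed p p<ξ
          in ξ , lim , <-trans α₀<η η<ξ

        rows : ∀ α → ∃[ μ ] Σ[ M ∈ (Carrier → Subset) ] Rows μ M ×
                 (Limit (↓ α) → α₀ < α → Covers α μ M)
        rows α with em {P = Limit (↓ α) × α₀ < α}
        ... | yes (lim , α₀<α) = let μ , M , r , covers = rows-at α lim α₀<α in μ , M , r , λ _ _ → covers
        -- A matrix has a row at every `α`. The row borrowed from `α₁` is filler, but it is nonempty
        -- and its entries still lie above `α₀`.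
        ... | no ¬good =
          let α₁ , lim , α₀<α₁ = some-limit
              μ , M , r , _ = rows-at α₁ lim α₀<α₁
          in μ , M , r , λ lim α₀<α → ⊥-elim (¬good (lim , α₀<α))

        j : Carrier → Carrier
        j = proj₁ ∘ rows

        M : Carrier → Carrier → Subset
        M = proj₁ ∘ proj₂ ∘ rows

        M-rows : ∀ α → Rows (j α) (M α)
        M-rows = proj₁ ∘ proj₂ ∘ proj₂ ∘ rows

        M-covers : ∀ α → Limit (↓ α) → α₀ < α → Covers α (j α) (M α)
        M-covers = proj₂ ∘ proj₂ ∘ proj₂ ∘ rows

        module Reflected (γ : Carrier) (F : Subset) (γ-cof : UncountableCofinality γ)
                         (F-stat : Stationary (↓ γ) F)
                         (reflects : ∀ α → α ∈ F → ∀ i → i < j α → ReflectsAt (M α i) γ) where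

          γ-bounded : SequencesBounded (↓ γ)
          γ-bounded = uncountableCofinality⇒sequencesBounded γ-cof

          above-γ : ∀ ξ → ξ < γ → ∃[ η ] η < γ × ξ < η
          above-γ ξ ξ<γ = let b , b<γ , ξ<b = γ-bounded (λ _ → ξ) (λ _ → ξ<γ) in b , b<γ , ξ<b 0

          F-element : ∃[ ξ ] ξ < γ × ξ ∈ F
          F-element = stationary⇒satisfiable F-stat

          γ-limit : Limit (↓ γ)
          γ-limit = (proj₁ F-element , proj₁ (proj₂ F-element)) , above-γ

          α₀<γ : α₀ < γ
          α₀<γ =
            let ξ , _ , ξ∈F = F-element
                _ , _ , i , i<j , α₀< = M-rows ξ
                β , β<γ , β∈M , _ = stationary⇒satisfiable (proj₂ (reflects ξ ξ∈F i i<j))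
            in <-trans (α₀< β∈M) β<γ

          module _ (D : Subset) (D∈𝒞 : D ∈ 𝒞 γ) where

            D-next : ∀ p → p < γ → ∃[ η ] η < γ × p < η × η ∈ D × α₀ < η
            D-next p p<γ =
              let m , p≤m , α₀≤m , m≡ = max p α₀
                  q , q<γ , m<q = above-γ m (max<γ m≡)
                  D⊆γ , D-unbounded , _ = clubs γ γ-limit D D∈𝒞
                  η , η∈D , q≤η = D-unbounded q q<γ
                  m<η = <-≤-trans m<q q≤η
              in η , D⊆γ η∈D , ≤-<-trans p≤m m<η , η∈D , ≤-<-trans α₀≤m m<η
              where
              max<γ : ∀ {m} → m ≡ p ⊎ m ≡ α₀ → m < γ
              max<γ (inj₁ refl) = p<γ
              max<γ (inj₂ refl) = α₀<γ

            -- Because `γ` has uncountable cofinality, the limit points of `D` beyond `α₀` include a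
            -- club in `γ`, which `X` meets.
            D-meets : (X : Subset) → Stationary (↓ γ) X → ∃[ ξ ] ξ ∈ X × α₀ < ξ × LimitPoint D ξ
            D-meets X X-stat =
              let ξ , ξ∈X , lim , closed = stationary-meets (↓ γ) <-trans γ-bounded X X-stat
                    {R = λ _ η → η ∈ D × α₀ < η} (λ _ → id) D-next
                  (p , p<ξ) , _ = lim
                  _ , η<ξ , _ , _ , α₀<η = closed p p<ξ
              in ξ , ξ∈X , <-trans α₀<η η<ξ , limit⇒limitPoint lim λ p p<ξ →
                   let η , η<ξ , p<η , η∈D , _ = closed p p<ξ in η , η<ξ , p<η , η∈D

            reflected-contradiction : ⊥
            reflected-contradiction =
              let α , α∈F , α₀<α , α-limD = D-meets F F-stat
                  α<γ = proj₁ F-stat α∈F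
                  i , i<j , M⊆ = M-covers α (proj₁ α-limD) α₀<α (D ∩ ↓ α)
                                   (coherent γ γ-limit D D∈𝒞 α α<γ α-limD)
                  β , (β∈M , β<γ) , _ , β-limD =
                    D-meets (M α i ∩ ↓ γ) (proj₂ (reflects α α∈F i i<j))
                  _ , α<β , ¬ext = unresize (M⊆ β∈M)
              -- By coherence `D ∩ ↓ β` belongs to `𝒞 β`, and it end-extends the very set that `β`
              -- was chosen to avoid.
              in ¬ext ( D ∩ ↓ β , coherent γ γ-limit D D∈𝒞 β β<γ β-limD
                      , limitPoint-cong (λ ξ<α ξ∈D → ξ∈D , <-trans ξ<α α<β) α-limD
                      , (λ ((ξ∈D , _) , ξ<α) → ξ∈D , ξ<α)
                      , (λ (ξ∈D , ξ<α) → (ξ∈D , <-trans ξ<α α<β) , ξ<α))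

        contradiction : ⊥
        contradiction =
          let γ , F , γ-cof , F-stat , reflects =
                reflection j M (proj₁ ∘ M-rows) (λ α → proj₁ (proj₂ (M-rows α)))
              open Reflected γ F γ-cof F-stat reflects
              D , D∈𝒞 = nonempty γ γ-limit
          in reflected-contradiction D D∈𝒞

      -- Unboundedly many nodes yield a thread.

      module NodeSequence (lev : Carrier → Carrier) (lev-mono : ∀ {i k} → i < k → lev i < lev k)
                          (node : ∀ i → Node (lev i)) where

        lev-limit : ∀ i → Limit (↓ (lev i))
        lev-limit = proj₁ ∘ node

        C : Carrier → Subset
        C = proj₁ ∘ proj₂ ∘ node

        C∈𝒞 : ∀ i → C i ∈ 𝒞 (lev i)
        C∈𝒞 = proj₁ ∘ proj₂ ∘ proj₂ ∘ node

        E : Carrier → Subset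
        E = proj₁ ∘ proj₂ ∘ proj₂ ∘ proj₂ ∘ node

        E-club : ∀ i → Club U (E i)
        E-club = proj₁ ∘ proj₂ ∘ proj₂ ∘ proj₂ ∘ proj₂ ∘ node

        E-extends : ∀ i β → β ∈ E i → β ∈ S → lev i < β → Extends (lev i) (C i) β
        E-extends = proj₂ ∘ proj₂ ∘ proj₂ ∘ proj₂ ∘ proj₂ ∘ node

        _≺_ : Rel Carrier a
        i ≺ k = i < k × LimitPoint (C k) (lev i) × (C k ∩ ↓ (lev i)) ≐ C i

        ≺-trans : Transitive _≺_
        ≺-trans (i<k , i-lim , Ck≐ , ≐Ck) (k<l , _ , Cl≐ , ≐Cl) =
          <-trans i<k k<l ,
          limitPoint-cong (λ _ ξ∈Ck → proj₁ (≐Cl ξ∈Ck)) i-lim ,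
          (λ (ξ∈Cl , ξ<i) → Ck≐ (Cl≐ (ξ∈Cl , <-trans ξ<i (lev-mono i<k)) , ξ<i)) ,
          (λ ξ∈Ci → let ξ∈Ck , ξ<i = ≐Ck ξ∈Ci in proj₁ (≐Cl ξ∈Ck) , ξ<i)

        -- Two initial segments of one set are comparable. This yields `≺-chain`, and in
        -- `no-antichain` it rules out two members extended by the same element of `𝒞 β`.
        common-extension : ∀ {i k} (D : Subset) → i < k → LimitPoint D (lev i) →
          (D ∩ ↓ (lev i)) ≐ C i → (D ∩ ↓ (lev k)) ≐ C k → i ≺ k
        common-extension D i<k i-lim (D≐i , i≐D) (D≐k , k≐D) =
          i<k , limitPoint-cong (λ ξ<i ξ∈D → D≐k (ξ∈D , <-trans ξ<i (lev-mono i<k))) i-lim ,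
          (λ (ξ∈Ck , ξ<i) → D≐i (proj₁ (k≐D ξ∈Ck) , ξ<i)) ,
          (λ ξ∈Ci → let ξ∈D , ξ<i = i≐D ξ∈Ci in D≐k (ξ∈D , <-trans ξ<i (lev-mono i<k)) , ξ<i)

        ≺-chain : ∀ {i k l} → i ≺ l → k ≺ l → i < k → i ≺ k
        ≺-chain {l = l} (_ , i-lim , i≐) (_ , _ , k≐) i<k = common-extension (C l) i<k i-lim i≐ k≐

        open Tree _≺_ proj₁ ≺-trans ≺-chain

        cone⇒thread : ∃ UnboundedCone → ∃[ T ] Thread 𝒞 T
        cone⇒thread (x , unbounded , chain) = T , (_ , T-unbounded , λ β _ → T-closed β) , T-coherent
          where
          T : Subset
          T ξ = ∃[ y ] x ≺ y × ξ ∈ C y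

          -- The cone is linearly ordered by end-extension, so `T` agrees with `C y` below `lev y`.
          -- Closure and coherence of `T` are thereby read off a single `C y`.
          T-restrict : ∀ {y ξ} → x ≺ y → ξ < lev y → ξ ∈ T → ξ ∈ C y
          T-restrict {y} x≺y ξ<y (z , x≺z , ξ∈Cz) with compare y z
          ... | tri< y<z _ _ = let _ , _ , Cz≐ , _ = chain x≺y x≺z y<z in Cz≐ (ξ∈Cz , ξ<y)
          ... | tri≈ _ refl _ = ξ∈Cz
          ... | tri> _ _ z<y = let _ , _ , _ , ≐Cy = chain x≺z x≺y z<y in proj₁ (≐Cy ξ∈Cz)

          cone-above : ∀ β → ∃[ y ] x ≺ y × β < lev y
          cone-above β =
            let y , x≺y , β<y = unbounded β
            in y , x≺y , <-≤-trans β<y (increasing⇒inflationary lev lev-mono y)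

          T-unbounded : Unbounded U T
          T-unbounded ξ _ =
            let y , x≺y , ξ<y = cone-above ξ
                η , η∈C , ξ≤η = proj₁ (proj₂ (clubs (lev y) (lev-limit y) (C y) (C∈𝒞 y))) ξ ξ<y
            in η , (y , x≺y , η∈C) , ξ≤η

          T-closed : ∀ β → LimitPoint T β → β ∈ T
          T-closed β β-lim =
            let y , x≺y , β<y = cone-above β
                _ , _ , C-closed = clubs (lev y) (lev-limit y) (C y) (C∈𝒞 y)
            in y , x≺y , C-closed β β<y
                 (limitPoint-cong (λ ξ<β → T-restrict x≺y (<-trans ξ<β β<y)) β-lim)

          T-coherent : ∀ β → LimitPoint T β → (T ∩ ↓ β) ∈ 𝒞 β
          T-coherent β β-lim =
            let y , x≺y , β<y = cone-above β
                restrict = λ {ξ} (ξ<β : ξ < β) → T-restrict x≺y (<-trans ξ<β β<y)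
            in extensional β (proj₁ β-lim)
                 ((λ (ξ∈C , ξ<β) → (y , x≺y , ξ∈C) , ξ<β) , (λ (ξ∈T , ξ<β) → restrict ξ<β ξ∈T , ξ<β))
                 (coherent (lev y) (lev-limit y) (C y) (C∈𝒞 y) β β<y (limitPoint-cong restrict β-lim))

        no-antichain : ¬ Antichain κ
        no-antichain (t , antichain) =
          let β , β∈S , β-limit , closed = stationary-meets U _ Λ-sequencesBounded S S-stat
                                             {R = Visited} Visited-antitone visit
          in Common.contradiction β β∈S β-limit closed
          where
          -- A substitute for intersecting `κ` clubs: a limit `β` closed under visits is a limit
          -- point of every `E (t i)` and lies beyond every `lev (t i)`.
          Visited : Rel Carrier a
          Visited p η = ∀ i → i < κ → ∃[ e ] e ∈ E (t i) × p < e × lev (t i) < e × e < η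

          Visited-antitone : ∀ {p q η} → p ≤ q → Visited q η → Visited p η
          Visited-antitone p≤q visited i i<κ =
            let e , e∈E , q<e , rest = visited i i<κ in e , e∈E , ≤-<-trans p≤q q<e , rest

          next-in-E : ∀ p i → i < κ → ∃[ e ] e ∈ E (t i) × p < e × lev (t i) < e
          next-in-E p i _ =
            let m , p≤m , lev≤m , _ = max p (lev (t i))
                q , m<q = above m
                e , e∈E , q≤e = proj₁ (proj₂ (E-club (t i))) q _
                m<e = <-≤-trans m<q q≤e
            in e , e∈E , ≤-<-trans p≤m m<e , ≤-<-trans lev≤m m<e

          visit : ∀ p → p ∈ U → ∃[ η ] η ∈ U × p < η × Visited p η
          visit p _ =
            let f , f-prop = choice origin κ (next-in-E p)
                -- The `κ` chosen points have a common bound because `κ` is below the regular `Λ`.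
                b , f<b = bound κ f
                m , p≤m , b≤m , _ = max p b
                η , m<η = above m
            in η , _ , ≤-<-trans p≤m m<η , λ i i<κ →
                 let f∈E , p<f , lev<f = f-prop i i<κ
                 in f i , f∈E , p<f , lev<f , <-trans (f<b i i<κ) (≤-<-trans b≤m m<η)

          module Common (β : Carrier) (β∈S : β ∈ S) (β-limit : Limit (↓ β))
                        (closed : ∀ p → p < β → ∃[ η ] η < β × p < η × Visited p η) where

            common-extends : ∀ i → i < κ → Extends (lev (t i)) (C (t i)) β
            common-extends i i<κ = E-extends (t i) β β∈E β∈S lev<β
              where
              β∈E : β ∈ E (t i)
              β∈E = proj₂ (proj₂ (E-club (t i))) β _ (limit⇒limitPoint β-limit λ p p<β →
                let η , η<β , _ , visited = closed p p<β
                    e , e∈E , p<e , _ , e<η = visited i i<κ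
                in e , <-trans e<η η<β , p<e , e∈E)

              lev<β : lev (t i) < β
              lev<β =
                let (p , p<β) , _ = β-limit
                    η , η<β , _ , visited = closed p p<β
                    e , _ , _ , lev<e , e<η = visited i i<κ
                in <-trans lev<e (<-trans e<η η<β)

            contradiction : ⊥
            contradiction =
              let μ , μ<κ , A , _ , A-onto = enumerate-collection (width β β-limit)
                  k , k-prop = choice origin κ
                    {P = λ i k → k < μ × LimitPoint (A k) (lev (t i)) × (A k ∩ ↓ (lev (t i))) ≐ C (t i)}
                    λ i i<κ →
                      let D , D∈𝒞 , i-lim , D≐i , i≐D = common-extends i i<κ
                          k , k<μ , A≐D , D≐A = A-onto D D∈𝒞
                      in k , k<μ , limitPoint-cong (λ _ → D≐A) i-lim ,
                         (λ (ξ∈A , ξ<i) → D≐i (A≐D ξ∈A , ξ<i)) ,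
                         (λ ξ∈C → let ξ∈D , ξ<i = i≐D ξ∈C in D≐A ξ∈D , ξ<i)
              -- If `k i` and `k l` were equal, one set would extend both members and so compare
              -- them. Hence `k` injects `κ` into the smaller `μ`.
              in cardinal⇒no-injection-below κ-cardinal μ<κ k (λ i i<κ → proj₁ (k-prop i i<κ))
                   λ {i} {l} i<l l<κ kᵢ≡kₗ →
                     let _ , i-lim , i≐ = k-prop i (<-trans i<l l<κ)
                         _ , _ , l≐ = k-prop l l<κ
                         tᵢ<tₗ , tᵢ⊀tₗ = antichain i<l l<κ
                     in tᵢ⊀tₗ (common-extension (A (k i)) tᵢ<tₗ i-lim i≐
                          (subst (λ z → (A z ∩ ↓ (lev (t l))) ≐ C (t l)) (sym kᵢ≡kₗ) l≐))

        thread : ∃[ T ] Thread 𝒞 T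
        thread with unboundedCone⊎antichain κ
        ... | inj₁ cone = cone⇒thread cone
        ... | inj₂ antichain = ⊥-elim (no-antichain antichain)

      -- The dichotomy on the levels of nodes.

      has-thread : ∃[ T ] Thread 𝒞 T
      has-thread with em {P = ∀ ξ → ∃[ α ] ξ < α × Node α}
      ... | no ¬unbounded =
        let α₀ , none = ¬∀⇒∃¬ ¬unbounded
        in ⊥-elim (BoundedNodes.contradiction α₀ λ α α₀<α node → none (α , α₀<α , node))
      ... | yes nodes =
        -- Each `s k` skips past the levels already used, and its node lies above `s k`, so the
        -- levels strictly increase.
        let s , _ , lev-s< = enumeration U (λ ξ → let η , ξ<η = above ξ in η , _ , ξ<η) (proj₁ ∘ nodes)
        in NodeSequence.thread (proj₁ ∘ nodes ∘ s)
             (λ {i} {k} i<k → <-trans (lev-s< i<k) (proj₁ (proj₂ (nodes (s k)))))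
             (λ i → proj₂ (proj₂ (nodes (s i))))

theorem2p1 : (∀ {ℓ : Level} → ExcludedMiddle ℓ) →
    ∀ {a : Level} (Λ : Ordinal a) → let open Below Λ in
    (κ : Carrier) →
    Regular → IsCardinal κ → (∃[ o ] IsOne o × o < κ) →
    (∃[ S ] Stationary U S × sDSR κ S) →
    ¬ □ κ
theorem2p1 em Λ κ regular κ-cardinal (o , _ , o<κ) (S , S-stat , reflection) (𝒞 , coh , width , no-thread) =
  no-thread (Classical.Order.Square.has-thread em Λ regular κ-cardinal o<κ S-stat reflection coh width)
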